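{- Let $G=(V,E,\mathrm{ant},\mathrm{cons})$ be an assertion graph for a circuit with closure function $F$. If $F\models_S G$ (that is, $F$ simply satisfies the assertion graph $G$), then for every STE-assertion $(A\Longrightarrow C)\in \mathrm{Ass}(G)$ we have $F\models_S (A\Longrightarrow C)$ (that is, $F$ simply satisfies the trajectory assertion $A\Longrightarrow C$).
   Context: **Values and states.** $\mathbb V=\{0,1,\mathsf X,\mathsf T\}$ is the lattice with least element $\mathsf X$, greatest element $\mathsf T$, and $0,1$ incomparable; $\sqcup,\sqcap$ denote least upper bound and greatest lower bound. A circuit has a finite set of nodes $\mathcal N$ and a subset $\mathcal S\subseteq\mathcal N$ of register outputs; the register with output $n\in\mathcal S$ has input node $n'\in\mathcal N$. A circuit state is a function $s:\mathcal N\to\mathbb V$; the set of states is $\mathsf{State}$, ordered pointwise. A closure function is a map $F:\mathsf{State}\to\mathsf{State}$ that is monotonic, idempotent ($F(F(s))=F(s)$) and extensive ($s\le F(s)$). For a state $s$, $\mathrm{next}(s)(n)=s(n')$ if $n\in\mathcal S$ and $\mathsf X$ otherwise. **STE.** A sequence of depth $d$ is a map $\sigma:\{0,\dots,d\}\to\mathsf{State}$. Define $F^{\to}(\sigma)$, of the same depth, by $F^{\to}(\sigma)(0)=F(\sigma(0))$ and $F^{\to}(\sigma)(t+1)=F(\sigma(t+1)\sqcup\mathrm{next}(F^{\to}(\sigma)(t)))$ for $0\le t\le d-1$. A trajectory of $F$ is a sequence $\tau$ with $\tau=F^{\to}(\tau)$. $W$ is a set of symbolic constants. TEL formulas: $f::=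 n\ \mathbf{is}\ 0\mid n\ \mathbf{is}\ 1\mid f_1\ \mathbf{and}\ f_2\mid P\to f\mid \mathbf N f$, with $n\in\mathcal N$ and $P$ a Boolean propositional formula over $W$. The depth of a formula is the maximal nesting degree of $\mathbf N$; the depth of $A\Longrightarrow C$ is the maximum of the depths of $A$ and $C$. For $\phi:W\to\{0,1\}$ and a sequence $\sigma$ of depth at least that of the formula: $\phi,\sigma\models n\ \mathbf{is}\ b$ iff $b\le\sigma(0)(n)$; $\phi,\sigma\models f_1\ \mathbf{and}\ f_2$ iff both hold; $\phi,\sigma\models P\to f$ iff ($\phi$ satisfies $P$ implies $\phi,\sigma\models f$); $\phi,\sigma\models\mathbf N f$ iff $\phi,\sigma^1\models f$, where $\sigma^1(t)=\sigma(t+1)$. For an STE-assertion of depth $d$, $F\models_S(A\Longrightarrow C)$ iff for every $\phi:W\to\{0,1\}$ and every trajectory $\tau$ of $F$ of depth $d$ (possibly containing the value $\mathsf T$): $\phi,\tau\models A$ implies $\phi,\tau\models C$. **Sequence graphs.** A sequence graph is a triple $(V,E,\Sigma)$ with $V$ a finite set of vertices containing the initial vertex $\mathsf{init}$, $E$ a set of directed edges (each $e$ has $\mathrm{start}(e),\mathrm{end}(e)\in V$; multiple edges allowed), and $\Sigma:E\to\mathsf{State}$. It is identified with $\Sigma$. Same-shape sequence graphs (same $V$ and $E$) are ordered pointwise. An edge is initial if it starts in $\mathsf{init}$; $\mathrm{in}(e)=\{e'\in E:\mathrm{end}(e')=\mathrm{start}(e)\}$. Only graphs in which every vertex and edge is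 reachable from $\mathsf{init}$ are considered. For $\Sigma$ and a same-shape $\Delta$ define $$F^{\circ}_{\Sigma}(\Delta)(e)=\begin{cases}F(\Sigma(e)) & e\text{ initial}\\ F\big(\Sigma(e)\sqcup \mathop{\sqcap}\limits_{i\in \mathrm{in}(e)}\mathrm{next}(\Delta(i))\big)&\text{otherwise,}\end{cases}$$ and let $F^{\circ}(\Sigma)$ be the greatest fixpoint of $F^\circ_\Sigma$. A trajectory graph of $F$ is a sequence graph $\Sigma$ with $F^\circ(\Sigma)=\Sigma$. **Assertion graphs.** GTEL is the set of TEL formulas without $\mathbf N$; $\phi,s\models f$ for a state $s$ is defined by the TEL clauses with $s$ in place of $\sigma(0)$ (so $\phi,s\models n\ \mathbf{is}\ b$ iff $b\le s(n)$). An assertion graph is $G=(V,E,\mathrm{ant},\mathrm{cons})$ with $V,E$ as for sequence graphs (including reachability) and $\mathrm{ant},\mathrm{cons}:E\to$ GTEL. For $f\in\{\mathrm{ant},\mathrm{cons}\}$ and a sequence graph $\Sigma$ of the same shape as $G$, $\phi,\Sigma\models f$ means $\phi,\Sigma(e)\models f(e)$ for all $e\in E$. $F\models_S G$ iff for all $\phi:W\to\{0,1\}$ and all trajectory graphs $\Sigma$ of $F$ of the same shape as $G$: $\phi,\Sigma\models\mathrm{ant}$ implies $\phi,\Sigma\models\mathrm{cons}$. A path of depth $d$ is a list of edges $\rho=(e_0,\dots,e_d)$ with $\mathrm{start}(e_{i+1})=\mathrm{end}(e_i)$, and $\rho(i)=e_i$; it is initial if $e_0$ is initial. For a finite initial path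 $\rho$ of depth $d$ in $G$, $\mathrm{Ass}(G,\rho)$ is the STE-assertion (of depth $d$) $$\Big(\mathop{\mathbf{and}}_{0\le i\le d}\mathbf N^i\,\mathrm{ant}(\rho(i))\Big)\Longrightarrow\Big(\mathop{\mathbf{and}}_{0\le i\le d}\mathbf N^i\,\mathrm{cons}(\rho(i))\Big),$$ and $\mathrm{Ass}(G)=\{\mathrm{Ass}(G,\rho):\rho\text{ a finite initial path in }G\}$. -}

module Defs where

open import Level using (0ℓ)
open import Algebra.Definitions using (IdempotentFun)
open import Data.Bool using (Bool; true; false; not; _∧_; _∨_)
open import Data.Fin using (Fin; zero; suc; toℕ; inject₁)
open import Data.Maybe using (Maybe; just; nothing; maybe′)
open import Data.Nat as ℕ using (ℕ; zero; suc)
open import Data.Nat.GeneralisedArithmetic using (fold)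
open import Data.Nat.Properties using (m⊔n≤o⇒m≤o; m⊔n≤o⇒n≤o; m≤m⊔n; m≤n⊔m)
open import Data.Product using (Σ; ∃-syntax; _×_; _,_; proj₁)
open import Data.Vec using (foldr₁; tabulate)
open import Function using (_∘_)
open import Relation.Binary.Construct.Closure.ReflexiveTransitive using (Star)
open import Relation.Binary.Definitions using (Monotonic₁)
open import Relation.Binary.Lattice.Definitions using (Supremum)
open import Relation.Binary.PropositionalEquality
  using (_≡_; _≢_; refl; cong)
open import Relation.Unary using (Pred)

------------------------------------------------------------------------
-- Values

data 𝕍 : Set where
  𝟎 𝟏 X T : 𝕍

infix 4 _≤ᵛ_
data _≤ᵛ_ : 𝕍 → 𝕍 → Set where
  X≤     : ∀ {v} → X ≤ᵛ v
  ≤T     : ∀ {v} → v ≤ᵛ T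
  ≤-refl : ∀ {v} → v ≤ᵛ v

infixl 6 _⊔ᵛ_
_⊔ᵛ_ : 𝕍 → 𝕍 → 𝕍
X ⊔ᵛ v = v
T ⊔ᵛ v = T
𝟎 ⊔ᵛ X = 𝟎
𝟎 ⊔ᵛ 𝟎 = 𝟎
𝟎 ⊔ᵛ 𝟏 = T
𝟎 ⊔ᵛ T = T
𝟏 ⊔ᵛ X = 𝟏
𝟏 ⊔ᵛ 𝟎 = T
𝟏 ⊔ᵛ 𝟏 = 𝟏
𝟏 ⊔ᵛ T = T

⊔ᵛ-supremum : Supremum _≤ᵛ_ _⊔ᵛ_
⊔ᵛ-supremum X y = X≤ , ≤-refl , λ _ _ q → q
⊔ᵛ-supremum T y = ≤-refl , ≤T , λ _ p _ → p
⊔ᵛ-supremum 𝟎 X = ≤-refl , X≤ , λ _ p _ → p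
⊔ᵛ-supremum 𝟎 𝟎 = ≤-refl , ≤-refl , λ _ p _ → p
⊔ᵛ-supremum 𝟎 𝟏 = ≤T , ≤T , λ { T _ _ → ≤-refl ; 𝟎 _ () ; 𝟏 () _ ; X () _ }
⊔ᵛ-supremum 𝟎 T = ≤T , ≤-refl , λ _ _ q → q
⊔ᵛ-supremum 𝟏 X = ≤-refl , X≤ , λ _ p _ → p
⊔ᵛ-supremum 𝟏 𝟎 = ≤T , ≤T , λ { T _ _ → ≤-refl ; 𝟎 () _ ; 𝟏 _ () ; X () _ }
⊔ᵛ-supremum 𝟏 𝟏 = ≤-refl , ≤-refl , λ _ p _ → p
⊔ᵛ-supremum 𝟏 T = ≤T , ≤-refl , λ _ _ q → q

bit : Bool → 𝕍
bit false = 𝟎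
bit true  = 𝟏

------------------------------------------------------------------------
-- Propositional formulas over the symbolic constants W

data BoolExpr (W : Set) : Set where
  var       : W → BoolExpr W
  tt ff     : BoolExpr W
  neg       : BoolExpr W → BoolExpr W
  conj disj : BoolExpr W → BoolExpr W → BoolExpr W

eval : ∀ {W} → (W → Bool) → BoolExpr W → Bool
eval φ (var w)    = φ w
eval φ tt         = true
eval φ ff         = false
eval φ (neg P)    = not (eval φ P)
eval φ (conj P Q) = eval φ P ∧ eval φ Q
eval φ (disj P Q) = eval φ P ∨ eval φ Q

------------------------------------------------------------------------
-- Circuits and states

record Circuit : Set where
  field
    size     : ℕ
    -- register n is just n′ when n is the output of a register with input n′,
    -- and nothing when n is not a register output.
    register : Fin size → Maybe (Fin size)

  Node : Set
  Node = Fin size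

  State : Set
  State = Node → 𝕍

  -- States are functions, so equality of states is taken pointwise.
  infix 4 _≈_ _≤_
  _≈_ _≤_ : State → State → Set
  s ≈ s′ = ∀ n → s n ≡ s′ n
  s ≤ s′ = ∀ n → s n ≤ᵛ s′ n

  infixl 6 _⊔_
  _⊔_ : State → State → State
  (s ⊔ s′) n = s n ⊔ᵛ s′ n

  next : State → State
  next s n = maybe′ s X (register n)

  IsMeet : {I : Set} → (I → State) → State → Set
  IsMeet f m = (∀ i → m ≤ f i) × (∀ s → (∀ i → s ≤ f i) → s ≤ m)

  Seq : ℕ → Set
  Seq d = Fin (suc d) → State

record ClosureFunction (𝒞 : Circuit) : Set where
  open Circuit 𝒞
  field
    fun        : State → State
    monotonic  : Monotonic₁ _≤_ _≤_ fun
    idempotent : IdempotentFun _≈_ fun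
    extensive  : ∀ s → s ≤ fun s

------------------------------------------------------------------------
-- Trajectory evaluation logic

module _ (𝒞 : Circuit) (W : Set) where
  open Circuit 𝒞

  infix  7 _is_
  infixr 6 _and_
  infixr 5 _⇒_
  data TEL : Set where
    _is_  : Node → Bool → TEL
    _and_ : TEL → TEL → TEL
    _⇒_   : BoolExpr W → TEL → TEL
    N     : TEL → TEL

  data NextFree : TEL → Set where
    is  : ∀ {n b} → NextFree (n is b)
    and : ∀ {f g} → NextFree f → NextFree g → NextFree (f and g)
    imp : ∀ {P f} → NextFree f → NextFree (P ⇒ f)

  GTEL : Set
  GTEL = Σ TEL NextFree

  infix 4 _⟹_
  record Assertion : Set where
    constructor _⟹_
    field
      antecedent consequent : TEL

module _ {𝒞 : Circuit} {W : Set} where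
  open Circuit 𝒞

  depth : TEL 𝒞 W → ℕ
  depth (n is b)  = 0
  depth (f and g) = depth f ℕ.⊔ depth g
  depth (P ⇒ f)   = depth f
  depth (N f)     = suc (depth f)

  depthᴬ : Assertion 𝒞 W → ℕ
  depthᴬ (A ⟹ C) = depth A ℕ.⊔ depth C

  Sat : ∀ {d} → (W → Bool) → Seq d → (f : TEL 𝒞 W) → .(depth f ℕ.≤ d) → Set
  Sat         φ σ (n is b)  p = bit b ≤ᵛ σ zero n
  Sat         φ σ (f and g) p =
    Sat φ σ f (m⊔n≤o⇒m≤o (depth f) (depth g) p) ×
    Sat φ σ g (m⊔n≤o⇒n≤o (depth f) (depth g) p)
  Sat         φ σ (P ⇒ f)   p = eval φ P ≡ true → Sat φ σ f p
  Sat {suc d} φ σ (N f)     p = Sat φ (σ ∘ suc) f (ℕ.s≤s⁻¹ p)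
  Sat {zero}  φ σ (N f)     ()

  -- The clauses of Sat with s in place of σ zero.
  SatStateᵗ : (W → Bool) → State → {f : TEL 𝒞 W} → NextFree 𝒞 W f → Set
  SatStateᵗ φ s (is {n} {b})  = bit b ≤ᵛ s n
  SatStateᵗ φ s (and p q)     = SatStateᵗ φ s p × SatStateᵗ φ s q
  SatStateᵗ φ s (imp {P} p)   = eval φ P ≡ true → SatStateᵗ φ s p

  SatState : (W → Bool) → State → GTEL 𝒞 W → Set
  SatState φ s (_ , p) = SatStateᵗ φ s p

------------------------------------------------------------------------
-- Trajectories

module _ {𝒞 : Circuit} (F : ClosureFunction 𝒞) where
  open Circuit 𝒞
  open ClosureFunction F renaming (fun to cl)

  -- The recursive call is made on the prefix σ ∘ inject₁, to be structural
  -- in the index; F→-suc is the usual recursion equation.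
  F→ : ∀ {d} → Seq d → Seq d
  F→         σ zero    = cl (σ zero)
  F→ {suc d} σ (suc t) = cl (σ (suc t) ⊔ next (F→ (σ ∘ inject₁) t))

  F→-prefix : ∀ {d} (σ : Seq (suc d)) t → F→ (σ ∘ inject₁) t ≡ F→ σ (inject₁ t)
  F→-prefix         σ zero    = refl
  F→-prefix {suc d} σ (suc t) =
    cong (λ s → cl (σ (inject₁ (suc t)) ⊔ next s)) (F→-prefix (σ ∘ inject₁) t)

  F→-suc : ∀ {d} (σ : Seq (suc d)) t →
           F→ σ (suc t) ≡ cl (σ (suc t) ⊔ next (F→ σ (inject₁ t)))
  F→-suc σ t = cong (λ s → cl (σ (suc t) ⊔ next s)) (F→-prefix σ t)

  IsTrajectory : ∀ {d} → Seq d → Set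
  IsTrajectory τ = ∀ t → τ t ≈ F→ τ t

infix 4 _⊨ˢ_
_⊨ˢ_ : ∀ {𝒞 W} → ClosureFunction 𝒞 → Assertion 𝒞 W → Set
_⊨ˢ_ {𝒞} {W} F a@(A ⟹ C) =
  ∀ (φ : W → Bool) (τ : Circuit.Seq 𝒞 (depthᴬ a)) → IsTrajectory F τ →
  Sat φ τ A (m≤m⊔n (depth A) (depth C)) → Sat φ τ C (m≤n⊔m (depth A) (depth C))

------------------------------------------------------------------------
-- Graphs

-- The edges form an arbitrary set, so parallel edges, even infinitely many,
-- are possible.
record Graph : Set₁ where
  field
    order     : ℕ

  Vertex : Set
  Vertex = Fin order

  field
    init      : Vertex
    Edge      : Set
    start end : Edge → Vertex

  _⟶_ : Vertex → Vertex → Set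
  u ⟶ v = ∃[ e ] start e ≡ u × end e ≡ v

  field
    -- An edge is reachable when its start is, so this covers edges as well.
    reachable : ∀ v → Star _⟶_ init v

  Initial : Edge → Set
  Initial e = start e ≡ init

  In : Edge → Set
  In e = ∃[ i ] end i ≡ start e

  Path : ℕ → Set
  Path d = Σ (Fin (suc d) → Edge) λ ρ →
    ∀ (i : Fin d) → start (ρ (suc i)) ≡ end (ρ (inject₁ i))

module _ {𝒞 : Circuit} (F : ClosureFunction 𝒞) (S : Graph) where
  open Circuit 𝒞
  open ClosureFunction F renaming (fun to cl)
  open Graph S

  SeqGraph : Set
  SeqGraph = Edge → State

  -- F°[ Σ ] Δ ↦ Δ′ says Δ′ = F°_Σ(Δ).  The meet of an arbitrary family of
  -- states exists classically but is not computable, so it is characterised by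
  -- IsMeet; the meet, and hence Δ′, is unique up to ≈.
  F°[_]_↦_ : SeqGraph → SeqGraph → SeqGraph → Set
  F°[ Σ ] Δ ↦ Δ′ = ∀ e →
    (Initial e → Δ′ e ≈ cl (Σ e)) ×
    (start e ≢ init →
      ∃[ m ] IsMeet {In e} (λ (i , _) → next (Δ i)) m × Δ′ e ≈ cl (Σ e ⊔ m))

  F°-Fixpoint : SeqGraph → SeqGraph → Set
  F°-Fixpoint Σ Δ = F°[ Σ ] Δ ↦ Δ

  -- Δ = F°(Σ)
  F°_↦_ : SeqGraph → SeqGraph → Set
  F° Σ ↦ Δ = F°-Fixpoint Σ Δ × (∀ Δ′ → F°-Fixpoint Σ Δ′ → ∀ e → Δ′ e ≤ Δ e)

  IsTrajectoryGraph : SeqGraph → Set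
  IsTrajectoryGraph Σ = F° Σ ↦ Σ

------------------------------------------------------------------------
-- Assertion graphs

record AssertionGraph (𝒞 : Circuit) (W : Set) : Set₁ where
  field
    graph : Graph
  open Graph graph public
  field
    ant cons : Edge → GTEL 𝒞 W

infix 4 _⊨ᴳ_
_⊨ᴳ_ : ∀ {𝒞 W} → ClosureFunction 𝒞 → AssertionGraph 𝒞 W → Set
_⊨ᴳ_ {𝒞} {W} F G =
  ∀ (φ : W → Bool) (Σ : SeqGraph F graph) → IsTrajectoryGraph F graph Σ →
  (∀ e → SatState φ (Σ e) (ant e)) → (∀ e → SatState φ (Σ e) (cons e))
  where open AssertionGraph G

module _ {𝒞 : Circuit} {W : Set} (G : AssertionGraph 𝒞 W) where
  open AssertionGraph G

  along : ∀ {d} → (Edge → GTEL 𝒞 W) → Path d → TEL 𝒞 W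
  along f (ρ , _) =
    foldr₁ _and_ (tabulate λ i → fold (proj₁ (f (ρ i))) N (toℕ i))

  pathAssertion : ∀ {d} → Path d → Assertion 𝒞 W
  pathAssertion ρ = along ant ρ ⟹ along cons ρ

  Ass : Pred (Assertion 𝒞 W) 0ℓ
  Ass a = ∃[ d ] Σ (Path d) λ ρ → Initial (proj₁ ρ zero) × a ≡ pathAssertion ρ

{-# OPTIONS --safe #-}

-- Given a trajectory τ satisfying the antecedents along ρ, label every edge e
-- with the weakest state satisfying ant(e), and let Δ be F° of this labelling.
-- Δ is a trajectory graph satisfying all antecedents, hence all consequents,
-- and Δ(ρ(i)) ≤ τ(i) by induction on i, so τ inherits the consequents.
--
-- Constructively, Δ is determined by a map m from vertices to states (the
-- meets over the incoming edges), which ranges over a finite lattice.  The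
-- largest post-fixpoint m exists up to double negation, and this suffices
-- because satisfaction of a formula is decidable.
module Submission where

open import Defs
open import Data.Bool using (Bool; true; false; if_then_else_)
import Data.Bool.Properties as Bool
open import Data.Fin using (Fin; zero; suc; toℕ; inject₁; _≟_)
open import Data.Fin.Induction using (<-weakInduction)
open import Data.Fin.Properties using (toℕ≤pred[n])
open import Data.Maybe using (just; nothing)
open import Data.Nat as ℕ using (ℕ; zero; suc; _+_)
import Data.Nat.Properties as ℕₚ
open import Data.Nat.GeneralisedArithmetic using (fold)
open import Data.Product using (∃-syntax; _×_; _,_; proj₁; proj₂)
open import Data.Vec using (foldr₁; tabulate)
open import Effect.Monad using (RawMonad)
open import Function using (_∘_; id)
open import Level using (0ℓ)
open import Relation.Binary.PropositionalEquality
  using (_≡_; _≢_; refl; sym; trans; cong; cong₂; subst)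
open import Relation.Nullary using (¬_; Dec; yes; no; contradiction)
open import Relation.Nullary.Decidable
  using (decidable-stable; ¬¬-excluded-middle; _×-dec_; _→-dec_)
open import Relation.Nullary.Negation using (¬¬-Monad)
open import Relation.Unary using (_∈_)

open RawMonad (¬¬-Monad {0ℓ}) using (pure; _>>=_)

-- Values

≤ᵛ-trans : ∀ {x y z} → x ≤ᵛ y → y ≤ᵛ z → x ≤ᵛ z
≤ᵛ-trans X≤     _      = X≤
≤ᵛ-trans ≤-refl q      = q
≤ᵛ-trans ≤T     ≤T     = ≤T
≤ᵛ-trans ≤T     ≤-refl = ≤T

≤ᵛ-antisym : ∀ {x y} → x ≤ᵛ y → y ≤ᵛ x → x ≡ y
≤ᵛ-antisym ≤-refl _      = refl
≤ᵛ-antisym X≤     X≤     = refl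
≤ᵛ-antisym X≤     ≤-refl = refl
≤ᵛ-antisym ≤T     ≤T     = refl
≤ᵛ-antisym ≤T     ≤-refl = refl

≤ᵛ-reflexive : ∀ {x y} → x ≡ y → x ≤ᵛ y
≤ᵛ-reflexive refl = ≤-refl

infix 4 _≤ᵛ?_
_≤ᵛ?_ : ∀ x y → Dec (x ≤ᵛ y)
X ≤ᵛ? _ = yes X≤
T ≤ᵛ? X = no λ ()
T ≤ᵛ? T = yes ≤T
T ≤ᵛ? 𝟎 = no λ ()
T ≤ᵛ? 𝟏 = no λ ()
𝟎 ≤ᵛ? X = no λ ()
𝟎 ≤ᵛ? T = yes ≤T
𝟎 ≤ᵛ? 𝟎 = yes ≤-refl
𝟎 ≤ᵛ? 𝟏 = no λ ()
𝟏 ≤ᵛ? X = no λ ()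
𝟏 ≤ᵛ? T = yes ≤T
𝟏 ≤ᵛ? 𝟎 = no λ ()
𝟏 ≤ᵛ? 𝟏 = yes ≤-refl

-- At `T` both bits are assumed below `y`, and only `T` lies above both.
≤ᵛ-fromBits : ∀ {x y} → (∀ b → bit b ≤ᵛ x → bit b ≤ᵛ y) → x ≤ᵛ y
≤ᵛ-fromBits {X} h = X≤
≤ᵛ-fromBits {𝟎} h = h false ≤-refl
≤ᵛ-fromBits {𝟏} h = h true ≤-refl
≤ᵛ-fromBits {T} {T} h = ≤T
≤ᵛ-fromBits {T} {X} h = contradiction (h true ≤T) λ ()
≤ᵛ-fromBits {T} {𝟎} h = contradiction (h true ≤T) λ ()
≤ᵛ-fromBits {T} {𝟏} h = contradiction (h false ≤T) λ ()

x≤x⊔y : ∀ x y → x ≤ᵛ x ⊔ᵛ y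
x≤x⊔y x y = proj₁ (⊔ᵛ-supremum x y)

y≤x⊔y : ∀ x y → y ≤ᵛ x ⊔ᵛ y
y≤x⊔y x y = proj₁ (proj₂ (⊔ᵛ-supremum x y))

⊔ᵛ-least : ∀ {x y z} → x ≤ᵛ z → y ≤ᵛ z → x ⊔ᵛ y ≤ᵛ z
⊔ᵛ-least {x} {y} = proj₂ (proj₂ (⊔ᵛ-supremum x y)) _

-- Largest elements of join-closed predicates

module _ {A : Set} {_∨_ : A → A → A} {P : A → Set} {z : A}
         (Pz : P z) (P-∨ : ∀ {x y} → P x → P y → P (x ∨ y)) where

  -- Upward closure phrased through joins, since `A` carries no order.
  Persistent : (A → Set) → Set
  Persistent Q = (∀ {x} y → Q x → Q (x ∨ y)) × (∀ x {y} → Q y → Q (x ∨ y))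

  Attainable : (A → Set) → Set
  Attainable Q = ¬ ¬ (∃[ x ] P x × Q x)

  -- Join a witness for the first index with one for the remaining indices; persistence keeps every
  -- `Q i` true of the join.
  attainable-Fin : ∀ {k} {Q : Fin k → A → Set} → (∀ i → Persistent (Q i)) →
                   (∀ i → Attainable (Q i)) → Attainable (λ x → ∀ i → Q i x)
  attainable-Fin {zero}  pers att = pure (z , Pz , λ ())
  attainable-Fin {suc k} pers att = do
    x , Px , q₀ ← att zero
    y , Py , q₊ ← attainable-Fin (pers ∘ suc) (att ∘ suc)
    pure (x ∨ y , P-∨ Px Py ,
      λ { zero    → proj₁ (pers zero) y q₀
        ; (suc i) → proj₂ (pers (suc i)) x (q₊ i) })

  attainable-Bool : {Q : Bool → A → Set} → (∀ b → Persistent (Q b)) →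
                    (∀ b → Attainable (Q b)) → Attainable (λ x → ∀ b → Q b x)
  attainable-Bool pers att = do
    x , Px , q₀ ← att false
    y , Py , q₁ ← att true
    pure (x ∨ y , P-∨ Px Py ,
      λ { false → proj₁ (pers false) y q₀ ; true → proj₂ (pers true) x q₁ })

  -- Under double negation, either some element of `P` satisfies `Q` and is taken, or none does and
  -- `z` works vacuously.
  attainable-→ : {Q : A → Set} → Attainable λ x → ∀ y → P y → Q y → Q x
  attainable-→ {Q} = do
    yes (x , Px , q) ← ¬¬-excluded-middle {A = ∃[ x ] P x × Q x}
      where no ¬q → pure (z , Pz , λ y Py q → contradiction (y , Py , q) ¬q)
    pure (x , Px , λ _ _ _ → q)

module _ {a b : ℕ} {P : (Fin a → Fin b → 𝕍) → Set} where

  Greatest : (Fin a → Fin b → 𝕍) → Set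
  Greatest m = P m × (∀ m′ → P m′ → ∀ v n → m′ v n ≤ᵛ m v n)

  -- Every value is the join of the bits below it, so it suffices to attain
  -- each bit of each coordinate separately and join the finitely many results.
  ¬¬-greatest : P (λ _ _ → X) →
                (∀ {m m′} → P m → P m′ → P λ v n → m v n ⊔ᵛ m′ v n) →
                ¬ ¬ (∃[ m ] Greatest m)
  ¬¬-greatest P⊥ P-⊔ = do
    m , Pm , h ←
      attainable-Fin P⊥ P-⊔
        (λ v → (λ m′ h n b m₀ P₀ q → ≤ᵛ-trans (h n b m₀ P₀ q) (x≤x⊔y _ _)) ,
               (λ m  h n b m₀ P₀ q → ≤ᵛ-trans (h n b m₀ P₀ q) (y≤x⊔y (m v n) _)))
        λ v → attainable-Fin P⊥ P-⊔
          (λ n → (λ m′ h b m₀ P₀ q → ≤ᵛ-trans (h b m₀ P₀ q) (x≤x⊔y _ _)) ,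
                 (λ m  h b m₀ P₀ q → ≤ᵛ-trans (h b m₀ P₀ q) (y≤x⊔y (m v n) _)))
          λ n → attainable-Bool P⊥ P-⊔
            (λ b → (λ m′ h m₀ P₀ q → ≤ᵛ-trans (h m₀ P₀ q) (x≤x⊔y _ _)) ,
                   (λ m  h m₀ P₀ q → ≤ᵛ-trans (h m₀ P₀ q) (y≤x⊔y (m v n) _)))
            λ b → attainable-→ P⊥ P-⊔ {Q = λ m → bit b ≤ᵛ m v n}
    pure (m , Pm , λ m′ Pm′ v n → ≤ᵛ-fromBits λ b → h v n b m′ Pm′)

-- Closure functions

module _ {𝒞 : Circuit} where
  open Circuit 𝒞

  next-mono : ∀ {s s′} → s ≤ s′ → next s ≤ next s′
  next-mono s≤s′ n with register n
  ... | just n′ = s≤s′ n′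
  ... | nothing = X≤

  ≤-transˢ : ∀ {s t u} → s ≤ t → t ≤ u → s ≤ u
  ≤-transˢ s≤t t≤u n = ≤ᵛ-trans (s≤t n) (t≤u n)

  s≤s⊔t : ∀ s t → s ≤ s ⊔ t
  s≤s⊔t s t n = x≤x⊔y (s n) (t n)

  t≤s⊔t : ∀ s t → t ≤ s ⊔ t
  t≤s⊔t s t n = y≤x⊔y (s n) (t n)

  ⊔-least : ∀ {s t u} → s ≤ u → t ≤ u → s ⊔ t ≤ u
  ⊔-least s≤u t≤u n = ⊔ᵛ-least (s≤u n) (t≤u n)

  module _ (F : ClosureFunction 𝒞) where
    open ClosureFunction F renaming (fun to cl)

    -- By monotonicity `cl s` is below `cl (cl t)`, which idempotence collapses.
    cl-least : ∀ {s t} → s ≤ cl t → cl s ≤ cl t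
    cl-least {s} {t} s≤clt n =
      ≤ᵛ-trans (monotonic s≤clt n) (≤ᵛ-reflexive (idempotent t n))

    trajectory-zero : ∀ {d} {τ : Seq d} → IsTrajectory F τ → cl (τ zero) ≤ τ zero
    trajectory-zero τ-traj n = ≤ᵛ-reflexive (sym (τ-traj zero n))

    trajectory-suc : ∀ {d} {τ : Seq (suc d)} → IsTrajectory F τ → ∀ t →
                     cl (τ (suc t) ⊔ next (τ (inject₁ t))) ≤ τ (suc t)
    trajectory-suc {τ = τ} τ-traj t n = ≤ᵛ-trans
      (monotonic
        (⊔-least (s≤s⊔t (τ (suc t)) _)
          (≤-transˢ (next-mono λ n → ≤ᵛ-reflexive (τ-traj (inject₁ t) n))
                    (t≤s⊔t (τ (suc t)) _)))
        n)
      (≤ᵛ-reflexive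
        (sym (trans (τ-traj (suc t) n) (cong (λ s → s n) (F→-suc F τ t)))))

    -- The greatest fixpoint of F°

    module _ (S : Graph) where
      open Graph S

      -- Whenever start e is not init, the largest m with IsVertexBound f m
      -- gives the meet of next (f i) over i ∈ in(e) as m (start e); initial
      -- edges receive no contribution, as m init is X.
      IsVertexBound : SeqGraph F S → (Vertex → State) → Set
      IsVertexBound f m = (∀ n → m init n ≤ᵛ X) × (∀ e → m (end e) ≤ next (f e))

      vertexBound⇒isMeet :
        ∀ {f m} → Greatest {P = IsVertexBound f} m → ∀ {v} → v ≢ init →
        IsMeet {∃[ i ] end i ≡ v} (λ (i , _) → next (f i)) (m v)
      vertexBound⇒isMeet {f} {m} ((_ , m≤) , m-max) {v} v≢init =
        (λ { (i , refl) → m≤ i }) , greatest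
        where
        greatest : ∀ s → (∀ ((i , _) : ∃[ i ] end i ≡ v) → s ≤ next (f i)) → s ≤ m v
        greatest s s≤ n = ≤ᵛ-trans (at-v n) (m-max at at-bound v n)
          where
          -- Test bound: the competing lower bound `s` at `v` and `X` elsewhere. It is admissible at
          -- `init` because `v` differs from `init`.
          at : Vertex → State
          at u with u ≟ v
          ... | yes _ = s
          ... | no  _ = λ _ → X

          at-v : s ≤ at v
          at-v n with v ≟ v
          ... | yes _  = ≤-refl
          ... | no v≢v = contradiction refl v≢v

          at-init : ∀ n → at init n ≤ᵛ X
          at-init n with init ≟ v
          ... | yes init≡v = contradiction (sym init≡v) v≢init
          ... | no _       = X≤

          at-end : ∀ e → at (end e) ≤ next (f e)
          at-end e n with end e ≟ v
          ... | yes end≡v = s≤ (e , end≡v) n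
          ... | no _      = X≤

          at-bound : IsVertexBound f at
          at-bound = at-init , at-end

      -- Post-fixpoints of propagation over vertices

      module _ (Σ : SeqGraph F S) where

        -- The value of F°_Σ at Δ when m collects the meets next (Δ i).
        propagate : (Vertex → State) → SeqGraph F S
        propagate m e = cl (Σ e ⊔ m (start e))

        propagate-mono : ∀ m m′ → (∀ v → m v ≤ m′ v) →
                         ∀ e → propagate m e ≤ propagate m′ e
        propagate-mono m m′ m≤m′ e = monotonic
          (⊔-least (s≤s⊔t (Σ e) _)
            (≤-transˢ (m≤m′ (start e)) (t≤s⊔t (Σ e) (m′ (start e)))))

        infixl 6 _⊔ᴹ_
        _⊔ᴹ_ : (Vertex → State) → (Vertex → State) → Vertex → State
        (m ⊔ᴹ m′) v = m v ⊔ m′ v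

        IsPostFixpoint : (Vertex → State) → Set
        IsPostFixpoint m = IsVertexBound (propagate m) m

        -- The edge condition on `m′` refers to propagation of the join, which is weaker than `m′`
        -- being a post-fixpoint. This lets bounds for other edge labellings be absorbed into `m`.
        ⊔-postFixpoint : ∀ m m′ → IsPostFixpoint m →
          (∀ n → m′ init n ≤ᵛ X) →
          (∀ e → m′ (end e) ≤ next (propagate (m ⊔ᴹ m′) e)) →
          IsPostFixpoint (m ⊔ᴹ m′)
        ⊔-postFixpoint m m′ (m-init , m-end) m′-init m′-end =
          (λ n → ⊔ᵛ-least (m-init n) (m′-init n)) ,
          λ e → ⊔-least
            (≤-transˢ (m-end e)
              (next-mono (propagate-mono m (m ⊔ᴹ m′) (λ v → s≤s⊔t (m v) (m′ v)) e)))
            (m′-end e)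

        ¬¬-greatestPostFixpoint : ¬ ¬ (∃[ m ] Greatest {P = IsPostFixpoint} m)
        ¬¬-greatestPostFixpoint =
          ¬¬-greatest ((λ _ → X≤) , λ _ _ → X≤)
            λ {m} {m′} m-post (m′-init , m′-end) →
              ⊔-postFixpoint m m′ m-post m′-init λ e →
                ≤-transˢ (m′-end e)
                  (next-mono (propagate-mono m′ (m ⊔ᴹ m′) (λ v → t≤s⊔t (m v) (m′ v)) e))

        module _ {m : Vertex → State} (m-greatest : Greatest {P = IsPostFixpoint} m) where
          private
            Δ : SeqGraph F S
            Δ = propagate m

            m-post : IsPostFixpoint m
            m-post = proj₁ m-greatest

            m-max : ∀ m′ → IsPostFixpoint m′ → ∀ v → m′ v ≤ m v
            m-max = proj₂ m-greatest

          label≤propagate : ∀ e → Σ e ≤ Δ e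
          label≤propagate e = ≤-transˢ (s≤s⊔t (Σ e) (m (start e))) (extensive _)

          bound≤propagate : ∀ e → m (start e) ≤ Δ e
          bound≤propagate e = ≤-transˢ (t≤s⊔t (Σ e) (m (start e))) (extensive _)

          -- If `m′` bounds `Δ`, monotonicity of propagation makes `m ⊔ᴹ m′` a post-fixpoint, so
          -- maximality of `m` gives `m′ ≤ m`. Hence `m` yields exact meets.
          greatestVertexBound : Greatest {P = IsVertexBound Δ} m
          greatestVertexBound = m-post , λ m′ (m′-init , m′-end) v n → ≤ᵛ-trans
            (y≤x⊔y (m v n) _)
            (m-max (m ⊔ᴹ m′)
              (⊔-postFixpoint m m′ m-post m′-init λ e →
                ≤-transˢ (m′-end e)
                  (next-mono (propagate-mono m (m ⊔ᴹ m′) (λ v → s≤s⊔t (m v) (m′ v)) e)))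
              v n)

          -- Each `Δ e` is closed and already lies above `m (start e)`, so relabelling by `Δ` and
          -- joining the meet again changes nothing.
          propagate-fixpoint : F°-Fixpoint F S Δ Δ
          propagate-fixpoint e =
            (λ _ n → ≤ᵛ-antisym (extensive (Δ e) n) (cl-least (λ _ → ≤-refl) n)) ,
            λ e≢init → m (start e) ,
              vertexBound⇒isMeet greatestVertexBound e≢init ,
              λ n → ≤ᵛ-antisym
                (≤-transˢ (s≤s⊔t (Δ e) (m (start e))) (extensive _) n)
                (cl-least (⊔-least (λ _ → ≤-refl) (bound≤propagate e)) n)

          -- A fixpoint Δ′ of F°_Δ with vertex meets m′ makes m ⊔ m′ a
          -- post-fixpoint, so m′ ≤ m.
          propagate-greatest : ∀ Δ′ → F°-Fixpoint F S Δ Δ′ → ∀ e → Δ′ e ≤ Δ e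
          -- The goal is a decidable comparison of values, so the vertex bound for `Δ′` may be
          -- chosen under double negation.
          propagate-greatest Δ′ Δ′-fix e n = decidable-stable (_ ≤ᵛ? _) do
            m′ , m′-greatest@((m′-init , m′-end) , _) ←
              ¬¬-greatest {P = IsVertexBound Δ′} ((λ _ → X≤) , λ _ _ → X≤)
                λ (i₁ , e₁) (i₂ , e₂) → (λ n → ⊔ᵛ-least (i₁ n) (i₂ n)) ,
                                        (λ e → ⊔-least (e₁ e) (e₂ e))
            let
              Δ′≤ : ∀ e → Δ′ e ≤ cl (Δ e ⊔ m′ (start e))
              Δ′≤ e = step m′-greatest e (start e ≟ init)

              m⊔m′-post : IsPostFixpoint (m ⊔ᴹ m′)
              m⊔m′-post = ⊔-postFixpoint m m′ m-post m′-init λ e →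
                ≤-transˢ (m′-end e)
                  (next-mono
                    (≤-transˢ (Δ′≤ e)
                      -- The label `Δ e` is itself a propagated value, so closing it again together
                      -- with `m′` stays below propagation of the join.
                      (cl-least
                        (⊔-least
                          (propagate-mono m (m ⊔ᴹ m′) (λ v → s≤s⊔t (m v) (m′ v)) e)
                          (≤-transˢ (t≤s⊔t (m (start e)) (m′ (start e)))
                            (≤-transˢ (t≤s⊔t (Σ e) ((m ⊔ᴹ m′) (start e))) (extensive _)))))))

              m′≤m : ∀ v → m′ v ≤ m v
              m′≤m v = ≤-transˢ (t≤s⊔t (m v) (m′ v)) (m-max (m ⊔ᴹ m′) m⊔m′-post v)
            pure (≤ᵛ-trans (Δ′≤ e n)
              (cl-least
                (⊔-least (λ _ → ≤-refl)
                  (≤-transˢ (m′≤m (start e)) (bound≤propagate e)))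
                n))
            where
            step : ∀ {m′} → Greatest {P = IsVertexBound Δ′} m′ → ∀ e →
                   Dec (start e ≡ init) → Δ′ e ≤ cl (Δ e ⊔ m′ (start e))
            step _ e (yes e≡init) n = ≤ᵛ-trans
              (≤ᵛ-reflexive (proj₁ (Δ′-fix e) e≡init n))
              (monotonic (s≤s⊔t (Δ e) _) n)
            -- The meet `k` supplied by the fixpoint is a lower bound, hence below the meet
            -- `m′ (start e)`.
            step {m′} m′-greatest e (no e≢init) n
              with k , (k≤ , _) , Δ′≈ ← proj₂ (Δ′-fix e) e≢init = ≤ᵛ-trans
              (≤ᵛ-reflexive (Δ′≈ n))
              (monotonic
                (⊔-least (s≤s⊔t (Δ e) _)
                  (≤-transˢ
                    (proj₂ (vertexBound⇒isMeet m′-greatest e≢init) k k≤)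
                    (t≤s⊔t (Δ e) (m′ (start e)))))
                n)

          propagate-isTrajectoryGraph : IsTrajectoryGraph F S Δ
          propagate-isTrajectoryGraph = propagate-fixpoint , propagate-greatest

          -- Comparison with trajectories along a path

          propagate-initial≤ : ∀ {s e} → Initial e → Σ e ≤ s → Δ e ≤ cl s
          propagate-initial≤ e≡init Σ≤s = monotonic (⊔-least Σ≤s
            λ n → ≤ᵛ-trans
              (subst (λ v → m v n ≤ᵛ X) (sym e≡init) (proj₁ m-post n)) X≤)

          -- Induction along the path: the bound at the start of the next edge is below `next` of
          -- `Δ` on the current edge, hence below `next` of the trajectory there. Monotonicity of
          -- `cl` and the trajectory equation finish the step.
          propagate≤trajectory :
            ∀ {d} ((ρ , _) : Path d) → Initial (ρ zero) →
            {τ : Seq d} → IsTrajectory F τ →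
            (∀ i → Σ (ρ i) ≤ τ i) → ∀ i → Δ (ρ i) ≤ τ i
          propagate≤trajectory {zero} _ ρ-init τ-traj Σ≤τ zero =
            ≤-transˢ (propagate-initial≤ ρ-init (Σ≤τ zero)) (trajectory-zero τ-traj)
          propagate≤trajectory {suc d} (ρ , ρ-path) ρ-init {τ} τ-traj Σ≤τ =
            <-weakInduction (λ i → Δ (ρ i) ≤ τ i)
              (≤-transˢ (propagate-initial≤ ρ-init (Σ≤τ zero)) (trajectory-zero τ-traj))
              λ i Δ≤τ → ≤-transˢ
                (monotonic
                  (⊔-least
                    (≤-transˢ (Σ≤τ (suc i)) (s≤s⊔t (τ (suc i)) _))
                    (≤-transˢ
                      (subst (λ v → m v ≤ next (Δ (ρ (inject₁ i))))
                             (sym (ρ-path i)) (proj₂ m-post (ρ (inject₁ i))))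
                      (≤-transˢ (next-mono Δ≤τ) (t≤s⊔t (τ (suc i)) _)))))
                (trajectory-suc τ-traj i)

-- Formulas

module _ {𝒞 : Circuit} {W : Set} (φ : W → Bool) where
  open Circuit 𝒞

  satStateᵗ? : ∀ s {f : TEL 𝒞 W} (p : NextFree 𝒞 W f) → Dec (SatStateᵗ φ s p)
  satStateᵗ? s (is {n} {b}) = bit b ≤ᵛ? s n
  satStateᵗ? s (and p q)    = satStateᵗ? s p ×-dec satStateᵗ? s q
  satStateᵗ? s (imp {P} p)  = (eval φ P Bool.≟ true) →-dec satStateᵗ? s p

  satStateᵗ-mono : ∀ {s s′} → s ≤ s′ → {f : TEL 𝒞 W} (p : NextFree 𝒞 W f) →
                   SatStateᵗ φ s p → SatStateᵗ φ s′ p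
  satStateᵗ-mono s≤s′ is        h       = ≤ᵛ-trans h (s≤s′ _)
  satStateᵗ-mono s≤s′ (and p q) (h , k) =
    satStateᵗ-mono s≤s′ p h , satStateᵗ-mono s≤s′ q k
  satStateᵗ-mono s≤s′ (imp p)   h       = satStateᵗ-mono s≤s′ p ∘ h

  weakestState : {f : TEL 𝒞 W} → NextFree 𝒞 W f → State
  weakestState (is {n} {b}) n′ with n ≟ n′
  ... | yes _ = bit b
  ... | no  _ = X
  weakestState (and p q)   = weakestState p ⊔ weakestState q
  weakestState (imp {P} p) = if eval φ P then weakestState p else λ _ → X

  weakestState-sat : {f : TEL 𝒞 W} (p : NextFree 𝒞 W f) →
                     SatStateᵗ φ (weakestState p) p
  weakestState-sat (is {n}) with n ≟ n
  ... | yes _  = ≤-refl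
  ... | no n≢n = contradiction refl n≢n
  weakestState-sat (and p q) =
    satStateᵗ-mono (s≤s⊔t {𝒞} (weakestState p) (weakestState q)) p (weakestState-sat p) ,
    satStateᵗ-mono (t≤s⊔t {𝒞} (weakestState p) (weakestState q)) q (weakestState-sat q)
  weakestState-sat (imp {P} p) holds rewrite holds = weakestState-sat p

  weakestState-least : ∀ {s} {f : TEL 𝒞 W} (p : NextFree 𝒞 W f) →
                       SatStateᵗ φ s p → weakestState p ≤ s
  weakestState-least (is {n}) h n′ with n ≟ n′
  ... | yes refl = h
  ... | no _     = X≤
  weakestState-least (and p q) (h , k) =
    ⊔-least {𝒞} (weakestState-least p h) (weakestState-least q k)
  weakestState-least (imp {P} p) h with eval φ P
  ... | true  = weakestState-least p (h refl)
  ... | false = λ _ → X≤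

  -- An equality of types, so that one induction gives both directions, also under implications.
  sat-nextFree : ∀ {d} (σ : Seq d) {f : TEL 𝒞 W} (p : NextFree 𝒞 W f)
                 .(le : depth f ℕ.≤ d) → Sat φ σ f le ≡ SatStateᵗ φ (σ zero) p
  sat-nextFree σ is          _ = refl
  sat-nextFree σ (and p q)   _ = cong₂ _×_ (sat-nextFree σ p _) (sat-nextFree σ q _)
  sat-nextFree σ (imp {P} p) _ =
    cong (λ A → eval φ P ≡ true → A) (sat-nextFree σ p _)

  sat-N^ : ∀ {d} (σ : Seq d) (i : Fin (suc d)) ((f , p) : GTEL 𝒞 W)
           .(le : depth (fold f N (toℕ i)) ℕ.≤ d) →
           Sat φ σ (fold f N (toℕ i)) le ≡ SatState φ (σ i) (f , p)
  sat-N^         σ zero    (f , p) _ = sat-nextFree σ p _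
  sat-N^ {suc d} σ (suc i) g       _ = sat-N^ (σ ∘ suc) i g _

  sat-⋀⁻ : ∀ {d e} (σ : Seq e) (g : Fin (suc d) → TEL 𝒞 W)
           .(le : depth (foldr₁ _and_ (tabulate g)) ℕ.≤ e) →
           Sat φ σ (foldr₁ _and_ (tabulate g)) le →
           ∀ i .(leᵢ : depth (g i) ℕ.≤ e) → Sat φ σ (g i) leᵢ
  sat-⋀⁻ {zero}  σ g le h       zero    _ = h
  sat-⋀⁻ {suc d} σ g le (h , _) zero    _ = h
  sat-⋀⁻ {suc d} σ g le (_ , h) (suc i) _ = sat-⋀⁻ σ (g ∘ suc) _ h i _

  sat-⋀⁺ : ∀ {d e} (σ : Seq e) (g : Fin (suc d) → TEL 𝒞 W)
           .(le : depth (foldr₁ _and_ (tabulate g)) ℕ.≤ e) →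
           (∀ i .(leᵢ : depth (g i) ℕ.≤ e) → Sat φ σ (g i) leᵢ) →
           Sat φ σ (foldr₁ _and_ (tabulate g)) le
  sat-⋀⁺ {zero}  σ g le h = h zero _
  sat-⋀⁺ {suc d} σ g le h = h zero _ , sat-⋀⁺ σ (g ∘ suc) _ (h ∘ suc)

-- Depths of formulas

module _ {𝒞 : Circuit} {W : Set} where

  depth-nextFree : {f : TEL 𝒞 W} → NextFree 𝒞 W f → depth f ≡ 0
  depth-nextFree is        = refl
  depth-nextFree (and p q) = cong₂ ℕ._⊔_ (depth-nextFree p) (depth-nextFree q)
  depth-nextFree (imp p)   = depth-nextFree p

  depth-N^ : ∀ k {f : TEL 𝒞 W} → NextFree 𝒞 W f → depth (fold f N k) ≡ k
  depth-N^ zero    p = depth-nextFree p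
  depth-N^ (suc k) p = cong suc (depth-N^ k p)

  -- The last conjunct is deepest. The offset `k` makes the induction go through, since dropping the
  -- first conjunct raises the initial depth by one.
  depth-⋀ : ∀ {d} k (g : Fin (suc d) → TEL 𝒞 W) →
            (∀ i → depth (g i) ≡ k + toℕ i) →
            depth (foldr₁ _and_ (tabulate g)) ≡ k + d
  depth-⋀ {zero}  k g h = h zero
  depth-⋀ {suc d} k g h = trans
    (cong₂ ℕ._⊔_ (h zero)
      (trans (depth-⋀ (suc k) (g ∘ suc) λ i → trans (h (suc i)) (ℕₚ.+-suc k (toℕ i)))
             (sym (ℕₚ.+-suc k d))))
    (ℕₚ.m≤n⇒m⊔n≡n (ℕₚ.+-monoʳ-≤ k ℕ.z≤n))

-- Path assertions

module _ {𝒞 : Circuit} {W : Set} (G : AssertionGraph 𝒞 W) where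
  open Circuit 𝒞
  open AssertionGraph G

  conjunct : ∀ {d} → (Edge → GTEL 𝒞 W) → Path d → Fin (suc d) → TEL 𝒞 W
  conjunct f (ρ , _) i = fold (proj₁ (f (ρ i))) N (toℕ i)

  depth-conjunct : ∀ {d} f (ρ : Path d) i → depth (conjunct f ρ i) ≡ toℕ i
  depth-conjunct f (ρ , _) i = depth-N^ (toℕ i) (proj₂ (f (ρ i)))

  depth-along : ∀ {d} f (ρ : Path d) → depth (along G f ρ) ≡ d
  depth-along f ρ = depth-⋀ 0 (conjunct f ρ) (depth-conjunct f ρ)

  depth-pathAssertion : ∀ {d} (ρ : Path d) → depthᴬ (pathAssertion G ρ) ≡ d
  depth-pathAssertion {d} ρ = trans
    (cong₂ ℕ._⊔_ (depth-along ant ρ) (depth-along cons ρ)) (ℕₚ.⊔-idem d)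

  sat-along⁻ : ∀ {d} φ (τ : Seq d) f (ρ : Path d) .(le : depth (along G f ρ) ℕ.≤ d) →
               Sat φ τ (along G f ρ) le → ∀ i → SatState φ (τ i) (f (proj₁ ρ i))
  sat-along⁻ {d} φ τ f ρ le h i =
    subst id (sat-N^ φ τ i (f (proj₁ ρ i)) leᵢ) (sat-⋀⁻ φ τ (conjunct f ρ) le h i leᵢ)
    where
    leᵢ : depth (conjunct f ρ i) ℕ.≤ d
    leᵢ = subst (ℕ._≤ d) (sym (depth-conjunct f ρ i)) (toℕ≤pred[n] i)

  sat-along⁺ : ∀ {d} φ (τ : Seq d) f (ρ : Path d) .(le : depth (along G f ρ) ℕ.≤ d) →
               (∀ i → SatState φ (τ i) (f (proj₁ ρ i))) → Sat φ τ (along G f ρ) le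
  sat-along⁺ φ τ f ρ le h = sat-⋀⁺ φ τ (conjunct f ρ) le λ i leᵢ →
    subst id (sym (sat-N^ φ τ i (f (proj₁ ρ i)) leᵢ)) (h i)

  trajectory-sat : ∀ {F : ClosureFunction 𝒞} → F ⊨ᴳ G → ∀ {d} (ρ : Path d) →
    Initial (proj₁ ρ zero) → ∀ φ {τ : Seq d} → IsTrajectory F τ →
    (∀ i → SatState φ (τ i) (ant (proj₁ ρ i))) →
    ∀ i → SatState φ (τ i) (cons (proj₁ ρ i))
  trajectory-sat {F} F⊨G ρ ρ-init φ {τ} τ-traj τ⊨ant i =
    decidable-stable (satStateᵗ? φ (τ i) (proj₂ (cons (proj₁ ρ i)))) do
      m , m-greatest ← ¬¬-greatestPostFixpoint F graph Σ
      pure (satStateᵗ-mono φ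
        (propagate≤trajectory F graph Σ m-greatest ρ ρ-init τ-traj
          (λ j → weakestState-least φ (proj₂ (ant (proj₁ ρ j))) (τ⊨ant j)) i)
        (proj₂ (cons (proj₁ ρ i)))
        (F⊨G φ (propagate F graph Σ m)
          (propagate-isTrajectoryGraph F graph Σ m-greatest)
          -- Each antecedent holds at its label, and `Δ` lies above the labels.
          (λ e → satStateᵗ-mono φ (label≤propagate F graph Σ m-greatest e)
                   (proj₂ (ant e)) (weakestState-sat φ (proj₂ (ant e))))
          (proj₁ ρ i)))
    where
    Σ : SeqGraph F graph
    Σ e = weakestState φ (proj₂ (ant e))

proposition4p1 : (𝒞 : Circuit) (W : Set) (F : ClosureFunction 𝒞) (G : AssertionGraph 𝒞 W) →
    F ⊨ᴳ G → ∀ (a : Assertion 𝒞 W) → a ∈ Ass G → F ⊨ˢ a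
proposition4p1 𝒞 W F G F⊨G _ (d , ρ , ρ-init , refl) φ τ τ-traj =
  sat (depth-pathAssertion G ρ) τ τ-traj _ _
  where
  open Circuit 𝒞
  open AssertionGraph G

  -- The assertion is evaluated at its computed depth, which equals `d` only propositionally.
  -- Generalising that depth to `k` allows matching on `refl` without transporting `τ`; irrelevance
  -- of the depth bounds lets any proofs of them serve.
  sat : ∀ {k} → k ≡ d → (τ : Seq k) → IsTrajectory F τ →
        .(leᴬ : depth (along G ant ρ) ℕ.≤ k) .(leᶜ : depth (along G cons ρ) ℕ.≤ k) →
        Sat φ τ (along G ant ρ) leᴬ → Sat φ τ (along G cons ρ) leᶜ
  sat refl τ τ-traj leᴬ leᶜ h =
    sat-along⁺ G φ τ cons ρ leᶜ
      (trajectory-sat G F⊨G ρ ρ-init φ τ-traj (sat-along⁻ G φ τ ant ρ leᴬ h))
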